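{- Let $t \geq 1$ and $k \geq 1$ be integers, and let $\mathcal{F}$ be a finite family of finite sets with $\alpha(\mathcal{F}) \geq t$ and $\beta(\mathcal{F},t) = \frac{l(\mathcal{F},t)}{|\mathcal{F}|}$. Let $\mathcal{A}_1, \dots, \mathcal{A}_k$ be cross-$t$-intersecting sub-families of $\mathcal{F}$ such that $\sum_{i=1}^k |\mathcal{A}_i|$ is maximum among all $k$-tuples of cross-$t$-intersecting sub-families of $\mathcal{F}$. Then \[\sum_{i=1}^k |\mathcal{A}_i| = \begin{cases} |\mathcal{F}| & \text{if } k \leq \frac{|\mathcal{F}|}{l(\mathcal{F},t)};\\ k\, l(\mathcal{F},t) & \text{if } k \geq \frac{|\mathcal{F}|}{l(\mathcal{F},t)}.\end{cases}\] Moreover, (i) if $k < \frac{|\mathcal{F}|}{l(\mathcal{F},t)}$, then $\mathcal{A}_i = \mathcal{A}_i^{t,- }$ for all $i \in [k]$, and $\mathcal{A}_1, \dots, \mathcal{A}_k$ partition $\mathcal{F}$; (ii) if $k > \frac{|\mathcal{F}|}{l(\mathcal{F},t)}$, then $\mathcal{A}_1 = \dots = \mathcal{A}_k = \mathcal{L}$ for some largest $t$-intersecting sub-family $\mathcal{L}$ of $\mathcal{F}$.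
   Context: All sets and families are finite. A family $\mathcal{A}$ is $t$-intersecting if $|A \cap B| \geq t$ for all $A, B \in \mathcal{A}$ with $A \neq B$. Families $\mathcal{A}_1, \dots, \mathcal{A}_k$ (not necessarily distinct or non-empty) are cross-$t$-intersecting if for all $i \neq j$, $|A \cap B| \geq t$ for every $A \in \mathcal{A}_i$, $B \in \mathcal{A}_j$. For non-empty $\mathcal{F}$: $\alpha(\mathcal{F}) = \max\{|F| : F \in \mathcal{F}\}$; $l(\mathcal{F},t)$ is the size of a largest $t$-intersecting sub-family of $\mathcal{F}$. For a family $\mathcal{A}$, $\mathcal{A}^{t,+} = \{A \in \mathcal{A} : |A \cap B| \geq t \text{ for all } B \in \mathcal{A}\setminus\{A\}\}$ and $\mathcal{A}^{t,- } = \mathcal{A} \setminus \mathcal{A}^{t,+}$. For $\mathcal{A} \subseteq \mathcal{F}$, $\beta(\mathcal{F},t,\mathcal{A}) = \frac{l(\mathcal{F},t) - |\mathcal{A}^{t,+}|}{|\mathcal{A}^{t,- }|}$ if $\mathcal{A}^{t,- } \neq \emptyset$, and $\frac{l(\mathcal{F},t)}{|\mathcal{F}|}$ otherwise; $\beta(\mathcal{F},t) = \min_{\mathcal{A} \subseteq \mathcal{F}} \beta(\mathcal{F},t,\mathcal{A})$. $[k] = \{1,\dots,k\}$. -}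

module Defs where

import Algebra.Properties.CommutativeMonoid.Sum
open import Data.Bool.Properties using () renaming (_≟_ to _≟ᵇ_)
open import Data.Fin.Base using (Fin)
open import Data.Fin.Subset using (Subset; _∩_; ∣_∣)
open import Data.Integer.Base as ℤ using (+_)
open import Data.List.Base using (List; []; _∷_; [_]; _++_; length; map; filter)
open import Data.List.Extrema.Nat using (max; v≤max⁺)
import Data.List.Extrema
import Data.List.Membership.DecPropositional as DecMembership
open import Data.List.Membership.Propositional using () renaming (_∈_ to _∈ˡ_)
open import Data.List.Membership.Propositional.Properties
  using (∈-++⁺ˡ; ∈-++⁺ʳ; ∈-map⁺; ∈-filter⁺; ∈-filter⁻)
open import Data.List.Relation.Unary.All using (All; []; _∷_; all?; tabulate)
open import Data.List.Relation.Unary.AllPairs.Core using ([]; _∷_)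
open import Data.List.Relation.Unary.Any using (Any; here; there)
open import Data.List.Relation.Unary.Unique.Propositional using (Unique)
open import Data.List.Relation.Unary.Unique.Propositional.Properties using (filter⁺)
open import Data.Nat.Base as ℕ using (ℕ; zero; suc; NonZero; _≤_; s≤s; z≤n; >-nonZero)
import Data.Nat.Properties as ℕ
open import Data.Product.Base using (∃; _×_; _,_; proj₁; proj₂)
open import Data.Rational.Base using (ℚ; _/_)
import Data.Rational.Properties as ℚ
open import Data.Sum.Base using (inj₂)
open import Data.Vec.Properties using (≡-dec)
open import Level using (0ℓ)
open import Relation.Binary.Bundles using (DecTotalOrder)
open import Relation.Binary.Definitions using (DecidableEquality)
open import Relation.Binary.PropositionalEquality.Core using (_≡_; _≢_; refl; sym; trans; subst)
open import Relation.Nullary using (¬_; Dec; yes; no; contradiction)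
open import Relation.Nullary.Decidable using (¬?; _→-dec_)
open import Relation.Unary using (Pred; Decidable)

open Data.List.Extrema (DecTotalOrder.totalOrder ℚ.≤-decTotalOrder) using () renaming (min to minℚ)

open Algebra.Properties.CommutativeMonoid.Sum ℕ.+-0-commutativeMonoid public
  using (sum; sum-syntax)

private
  variable
    n k : ℕ

_≟_ : DecidableEquality (Subset n)
_≟_ = ≡-dec _≟ᵇ_

_∈ˡ?_ : (X : Subset n) (xs : List (Subset n)) → Dec (X ∈ˡ xs)
_∈ˡ?_ = DecMembership._∈?_ _≟_

-- A finite family of finite sets has a finite union, whose points are labelled
-- in Fin n.  The order of the list is immaterial: families are compared by _≈_.
record Family (n : ℕ) : Set where
  constructor mkFamily
  field
    members : List (Subset n)
    unique  : Unique members

open Family public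

infix 4 _∈_ _∉_ _⊆_ _≈_ _∈?_

_∈_ _∉_ : Subset n → Family n → Set
X ∈ 𝒜 = X ∈ˡ members 𝒜
X ∉ 𝒜 = ¬ (X ∈ 𝒜)

_⊆_ _≈_ : Family n → Family n → Set
𝒜 ⊆ ℬ = ∀ {X} → X ∈ 𝒜 → X ∈ ℬ
𝒜 ≈ ℬ = 𝒜 ⊆ ℬ × ℬ ⊆ 𝒜

_∈?_ : (X : Subset n) (𝒜 : Family n) → Dec (X ∈ 𝒜)
X ∈? 𝒜 = X ∈ˡ? members 𝒜

size : Family n → ℕ
size 𝒜 = length (members 𝒜)

NonEmpty : Family n → Set
NonEmpty 𝒜 = NonZero (size 𝒜)

select : {P : Pred (Subset n) 0ℓ} → Decidable P → Family n → Family n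
select P? (mkFamily xs u) = mkFamily (filter P? xs) (filter⁺ P? u)

infixl 6 _∖_

_∖_ : Family n → Family n → Family n
𝒜 ∖ ℬ = select (λ X → ¬? (X ∈? ℬ)) 𝒜

-- The base value 0 matters only when ℱ is empty.
α : Family n → ℕ
α ℱ = max 0 (map ∣_∣ (members ℱ))

MeetsOthers : ℕ → Family n → Pred (Subset n) 0ℓ
MeetsOthers t 𝒜 X = All (λ Y → X ≢ Y → t ≤ ∣ X ∩ Y ∣) (members 𝒜)

meetsOthers? : ∀ t (𝒜 : Family n) → Decidable (MeetsOthers t 𝒜)
meetsOthers? t 𝒜 X =
  all? (λ Y → ¬? (X ≟ Y) →-dec (t ℕ.≤? ∣ X ∩ Y ∣)) (members 𝒜)

Intersecting : ℕ → Pred (Family n) 0ℓ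
Intersecting t 𝒜 = All (MeetsOthers t 𝒜) (members 𝒜)

intersecting? : ∀ t → Decidable (Intersecting {n} t)
intersecting? t 𝒜 = all? (meetsOthers? t 𝒜) (members 𝒜)

CrossIntersecting : ℕ → (Fin k → Family n) → Set
CrossIntersecting t 𝒜 =
  ∀ {i j} → i ≢ j → ∀ {X Y} → X ∈ 𝒜 i → Y ∈ 𝒜 j → t ≤ ∣ X ∩ Y ∣

infix 8 _^[_,+] _^[_,-]

_^[_,+] _^[_,-] : Family n → ℕ → Family n
𝒜 ^[ t ,+] = select (meetsOthers? t 𝒜) 𝒜
𝒜 ^[ t ,-] = 𝒜 ∖ 𝒜 ^[ t ,+]

sublists : ∀ {A : Set} → List A → List (List A)
sublists []       = [ [] ]
sublists (x ∷ xs) = map (x ∷_) (sublists xs) ++ sublists xs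

-- Every sub-family of ℱ, up to _≈_ (see subfamilies-complete): for each sublist S
-- of members ℱ, the members of ℱ that lie in S; selecting from ℱ keeps uniqueness.
subfamilies : Family n → List (Family n)
subfamilies ℱ = map (λ S → select (_∈ˡ? S) ℱ) (sublists (members ℱ))

-- The default value 0 is harmless: the empty family is t-intersecting.
l : Family n → ℕ → ℕ
l ℱ t = max 0 (map size (filter (intersecting? t) (subfamilies ℱ)))

IsLargestIntersecting : ℕ → Family n → Family n → Set
IsLargestIntersecting t ℱ ℒ =
  ℒ ⊆ ℱ × Intersecting t ℒ ×
  (∀ 𝒢 → 𝒢 ⊆ ℱ → Intersecting t 𝒢 → size 𝒢 ≤ size ℒ)

βsub : (ℱ : Family n) .{{_ : NonEmpty ℱ}} → ℕ → Family n → ℚ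
βsub ℱ t 𝒜 with size (𝒜 ^[ t ,-])
... | zero      = + l ℱ t / size ℱ
... | m@(suc _) = (+ l ℱ t ℤ.- + size (𝒜 ^[ t ,+])) / m

-- The default value is one of the values being minimised, as ℱ ⊆ ℱ.
β : (ℱ : Family n) .{{_ : NonEmpty ℱ}} → ℕ → ℚ
β ℱ t = minℚ (βsub ℱ t ℱ) (map (βsub ℱ t) (subfamilies ℱ))

CrossSubfamilies : ℕ → Family n → (Fin k → Family n) → Set
CrossSubfamilies t ℱ 𝒜 = (∀ i → 𝒜 i ⊆ ℱ) × CrossIntersecting t 𝒜

IsMaximumCross : ℕ → Family n → (Fin k → Family n) → Set
IsMaximumCross {k = k} t ℱ 𝒜 =
  CrossSubfamilies t ℱ 𝒜 ×
  (∀ ℬ → CrossSubfamilies t ℱ ℬ → ∑[ i < k ] size (ℬ i) ≤ ∑[ i < k ] size (𝒜 i))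

-- Blocks may be empty: when ∑ᵢ |𝒜ᵢ| is maximum, some of the 𝒜ᵢ may well be ∅.
Partitions : (Fin k → Family n) → Family n → Set
Partitions 𝒜 ℱ =
  (∀ i → 𝒜 i ⊆ ℱ) ×
  (∀ {X} → X ∈ ℱ → ∃ λ i → X ∈ 𝒜 i) ×
  (∀ {i j} → i ≢ j → ∀ {X} → X ∈ 𝒜 i → X ∉ 𝒜 j)

private
  filter∈sublists : ∀ {A : Set} {P : Pred A 0ℓ} (P? : Decidable P) xs →
                    filter P? xs ∈ˡ sublists xs
  filter∈sublists P? []       = here refl
  filter∈sublists P? (x ∷ xs) with P? x
  ... | yes _ = ∈-++⁺ˡ (∈-map⁺ (x ∷_) (filter∈sublists P? xs))
  ... | no  _ = ∈-++⁺ʳ (map (x ∷_) (sublists xs)) (filter∈sublists P? xs)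

  ∈⇒size>0 : ∀ {X : Subset n} 𝒜 → X ∈ 𝒜 → 1 ≤ size 𝒜
  ∈⇒size>0 (mkFamily (_ ∷ _) _) _ = s≤s z≤n

subfamilies-complete : ∀ {𝒢 ℱ : Family n} → 𝒢 ⊆ ℱ →
                       ∃ λ 𝒢′ → 𝒢′ ∈ˡ subfamilies ℱ × 𝒢′ ≈ 𝒢
subfamilies-complete {𝒢 = 𝒢} {ℱ} 𝒢⊆ℱ =
  select (_∈ˡ? S) ℱ , ∈-map⁺ (λ S′ → select (_∈ˡ? S′) ℱ) (filter∈sublists (_∈? 𝒢) (members ℱ)) ,
  (λ X∈ → proj₂ (∈-filter⁻ (_∈? 𝒢) {xs = members ℱ}
            (proj₂ (∈-filter⁻ (_∈ˡ? S) {xs = members ℱ} X∈)))) ,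
  (λ X∈ → ∈-filter⁺ (_∈ˡ? S) (𝒢⊆ℱ X∈) (∈-filter⁺ (_∈? 𝒢) (𝒢⊆ℱ X∈) X∈))
  where
  S = filter (_∈? 𝒢) (members ℱ)

-- A one-member sub-family is t-intersecting, so l(ℱ,t) ≥ 1.
l-nonZero : ∀ (ℱ : Family n) t .{{_ : NonEmpty ℱ}} → NonZero (l ℱ t)
l-nonZero ℱ@(mkFamily (X ∷ _) _) t = >-nonZero (v≤max⁺ 0 _ (inj₂ (lemma (∈-map⁺ size 𝒢∈))))
  where
  single = mkFamily [ X ] ([] ∷ [])
  complete = subfamilies-complete {𝒢 = single} {ℱ} (λ { (here eq) → here eq })
  𝒢 = proj₁ complete
  only : ∀ {Y} → Y ∈ 𝒢 → Y ≡ X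
  only Y∈ with proj₁ (proj₂ (proj₂ complete)) Y∈
  ... | here eq = eq
  𝒢∈ : 𝒢 ∈ˡ filter (intersecting? t) (subfamilies ℱ)
  𝒢∈ = ∈-filter⁺ (intersecting? t) (proj₁ (proj₂ complete))
         (tabulate λ Y∈ → tabulate λ Z∈ Y≢Z →
           contradiction (trans (only Y∈) (sym (only Z∈))) Y≢Z)
  1≤ : 1 ≤ size 𝒢
  1≤ = ∈⇒size>0 𝒢 (proj₂ (proj₂ (proj₂ complete)) (here refl))
  lemma : ∀ {xs} → size 𝒢 ∈ˡ xs → Any (1 ≤_) xs
  lemma (here eq)  = here (subst (1 ≤_) eq 1≤)
  lemma (there p) = there (lemma p)

size/l : (ℱ : Family n) .{{_ : NonEmpty ℱ}} → ℕ → ℚ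
size/l ℱ t = (+ size ℱ / l ℱ t) {{l-nonZero ℱ t}}

{-# OPTIONS --safe #-}

-- Let 𝒰 be the union of the 𝒜ᵢ.  A member of two distinct 𝒜ᵢ lies in 𝒰⁺, so
-- ∑ᵢ |𝒜ᵢ| ≤ |𝒰⁻| + k |𝒰⁺|, while the hypothesis on β, applied to 𝒰, says
-- l |𝒰⁻| + |ℱ| |𝒰⁺| ≤ |ℱ| l.  Comparing k l with |ℱ| bounds the sum by |ℱ| or by
-- k l; both values are attained, by (ℱ, ∅, …, ∅) and by (ℒ, …, ℒ) respectively,
-- and a strict comparison forces 𝒰⁺, respectively 𝒰⁻, to be empty.
module Submission where

import Algebra.Properties.CommutativeMonoid.Sum
open import Data.Fin.Base using (Fin; zero; suc)
import Data.Fin.Properties as Fin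
open import Data.Fin.Subset using (_∩_; ∣_∣)
open import Data.Fin.Subset.Properties using (∩-idem; ∣p∩q∣≤∣p∣)
open import Data.Integer.Base as ℤ using (+_)
import Data.Integer.Properties as ℤ
open import Data.List.Base using (List; []; _∷_; _++_; length; concat; tabulate; map)
open import Data.List.Extrema.Nat using (argmax-sel; argmax-all; xs≤max)
import Data.List.Extrema
open import Data.List.Membership.Propositional using () renaming (_∈_ to _∈ˡ_)
open import Data.List.Membership.Propositional.Properties
  using (∈-∃++; ∈-map⁺; ∈-map⁻; ∈-filter⁺; ∈-filter⁻; ∈-tabulate⁻;
         ∈-concat⁻′; ∈-++⁺ˡ; ∈-++⁺ʳ)
open import Data.List.Properties using (length-++)
open import Data.List.Relation.Binary.Permutation.Propositional.Properties
  using (shift; ↭-length; ∈-resp-↭)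
open import Data.List.Relation.Binary.Subset.Propositional using () renaming (_⊆_ to _⊆ˡ_)
import Data.List.Relation.Unary.All as All
import Data.List.Relation.Unary.All.Properties as All
import Data.List.Relation.Unary.AllPairs.Properties as AllPairs
open import Data.List.Relation.Unary.Any using (here; there)
open import Data.List.Relation.Unary.Unique.Propositional using (Unique; []; _∷_)
import Data.List.Relation.Unary.Unique.Propositional.Properties as Unique
open import Data.Nat.Base using (ℕ; zero; suc; NonZero; _+_; _*_; _∸_; _≤_; _<_; z≤n; s≤s; ≢-nonZero)
open import Data.Nat.Properties
open import Data.Nat.Tactic.RingSolver using (solve-∀)
open import Data.Product.Base using (∃; _×_; _,_; proj₁; proj₂)
open import Data.Rational.Base as ℚ using (_/_)
import Data.Rational.Properties as ℚ
import Data.Rational.Unnormalised.Base as ℚᵘ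
import Data.Rational.Unnormalised.Properties as ℚᵘ
open import Data.Sum.Base using (inj₁; inj₂)
open import Function.Base using (_∘_)
open import Relation.Binary.Bundles using (DecTotalOrder)
open import Relation.Binary.PropositionalEquality
  using (_≡_; _≢_; refl; sym; trans; cong; cong₂; subst; subst₂)
open import Relation.Nullary using (yes; no; contradiction)
open import Relation.Nullary.Decidable using (¬?; decidable-stable)
open import Defs renaming (_≟_ to _≟ˢ_)

open Data.List.Extrema (DecTotalOrder.totalOrder ℚ.≤-decTotalOrder) using (min≤xs)
open Algebra.Properties.CommutativeMonoid.Sum +-0-commutativeMonoid using (∑-distrib-+)

private
  variable
    n k : ℕ

-- Finite sums

∑-mono-≤ : {f g : Fin k → ℕ} → (∀ i → f i ≤ g i) → sum f ≤ sum g
∑-mono-≤ {zero}  f≤g = z≤n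
∑-mono-≤ {suc k} f≤g = +-mono-≤ (f≤g zero) (∑-mono-≤ (f≤g ∘ suc))

∑-const : ∀ k m → ∑[ i < k ] m ≡ k * m
∑-const zero    m = refl
∑-const (suc k) m = cong₂ _+_ refl (∑-const k m)

-- Lowering every other summand of `g` to that of `f` preserves the inequality between the sums, and
-- those summands then cancel. This later forces each `𝒜 i` to be as large as possible.
∑-mono-≤-tight : {f g : Fin k → ℕ} → (∀ i → f i ≤ g i) → sum g ≤ sum f → ∀ i → g i ≤ f i
∑-mono-≤-tight {suc k} {f} {g} f≤g ∑g≤∑f zero =
  +-cancelʳ-≤ (sum (f ∘ suc)) _ _
    (≤-trans (+-monoʳ-≤ (g zero) (∑-mono-≤ (f≤g ∘ suc))) ∑g≤∑f)
∑-mono-≤-tight {suc k} {f} {g} f≤g ∑g≤∑f (suc i) =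
  ∑-mono-≤-tight (f≤g ∘ suc)
    (+-cancelˡ-≤ (f zero) _ _ (≤-trans (+-monoˡ-≤ _ (f≤g zero)) ∑g≤∑f)) i

-- Sizes of families

-- Pigeonhole by induction on `xs`: delete one occurrence of `x` from `ys`; as `x` does not recur in
-- `xs`, the tail is still contained in what remains.
length-mono-⊆ : ∀ {A : Set} {xs ys : List A} → Unique xs → xs ⊆ˡ ys → length xs ≤ length ys
length-mono-⊆ [] _ = z≤n
length-mono-⊆ {xs = x ∷ xs} (x∉xs ∷ u) xs⊆ys with ∈-∃++ (xs⊆ys (here refl))
... | ys₁ , ys₂ , refl =
  subst (suc (length xs) ≤_) (sym (↭-length (shift x ys₁ ys₂))) (s≤s (length-mono-⊆ u xs⊆))
  where
  xs⊆ : xs ⊆ˡ ys₁ ++ ys₂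
  xs⊆ y∈xs with ∈-resp-↭ (shift x ys₁ ys₂) (xs⊆ys (there y∈xs))
  ... | here refl = contradiction refl (All.lookup x∉xs y∈xs)
  ... | there y∈  = y∈

size-mono-⊆ : {𝒜 ℬ : Family n} → 𝒜 ⊆ ℬ → size 𝒜 ≤ size ℬ
size-mono-⊆ {𝒜 = 𝒜} 𝒜⊆ℬ = length-mono-⊆ (unique 𝒜) 𝒜⊆ℬ

-- A member of `ℬ` outside `𝒜` could be prepended to `𝒜`, giving a duplicate-free list inside `ℬ`
-- that is longer than `ℬ`.
⊆∧≥⇒⊇ : {𝒜 ℬ : Family n} → 𝒜 ⊆ ℬ → size ℬ ≤ size 𝒜 → ℬ ⊆ 𝒜
⊆∧≥⇒⊇ {𝒜 = 𝒜} {ℬ} 𝒜⊆ℬ ∣ℬ∣≤∣𝒜∣ {X} X∈ℬ = decidable-stable (X ∈? 𝒜) λ X∉𝒜 →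
  ≤⇒≯ ∣ℬ∣≤∣𝒜∣ (length-mono-⊆ {xs = X ∷ members 𝒜}
    (All.tabulate (λ Y∈𝒜 X≡Y → X∉𝒜 (subst (_∈ 𝒜) (sym X≡Y) Y∈𝒜)) ∷ unique 𝒜)
    λ { (here refl) → X∈ℬ ; (there Y∈𝒜) → 𝒜⊆ℬ Y∈𝒜 })

size≡0⇒∉ : (𝒜 : Family n) → size 𝒜 ≡ 0 → ∀ {X} → X ∉ 𝒜
size≡0⇒∉ (mkFamily [] _) _ ()

∈-∖⁺ : {𝒜 ℬ : Family n} → ∀ {X} → X ∈ 𝒜 → X ∉ ℬ → X ∈ 𝒜 ∖ ℬ
∈-∖⁺ {ℬ = ℬ} = ∈-filter⁺ (λ X → ¬? (X ∈? ℬ))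

∈-∖⁻ : (𝒜 ℬ : Family n) → ∀ {X} → X ∈ 𝒜 ∖ ℬ → X ∈ 𝒜 × X ∉ ℬ
∈-∖⁻ 𝒜 ℬ = ∈-filter⁻ (λ X → ¬? (X ∈? ℬ)) {xs = members 𝒜}

size≤size+size-∖ : (𝒜 ℬ : Family n) → size 𝒜 ≤ size ℬ + size (𝒜 ∖ ℬ)
size≤size+size-∖ 𝒜 ℬ =
  subst (size 𝒜 ≤_) (length-++ (members ℬ)) (length-mono-⊆ (unique 𝒜) 𝒜⊆)
  where
  𝒜⊆ : members 𝒜 ⊆ˡ members ℬ ++ members (𝒜 ∖ ℬ)
  𝒜⊆ {X} X∈𝒜 with X ∈? ℬ
  ... | yes X∈ℬ = ∈-++⁺ˡ X∈ℬ
  ... | no  X∉ℬ = ∈-++⁺ʳ (members ℬ) (∈-∖⁺ {𝒜 = 𝒜} {ℬ} X∈𝒜 X∉ℬ)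

-- Disjoint unions

Disjoint : (Fin k → Family n) → Set
Disjoint 𝒜 = ∀ {i j} → i ≢ j → ∀ {X} → X ∈ 𝒜 i → X ∉ 𝒜 j

⨆ : (𝒜 : Fin k → Family n) → Disjoint 𝒜 → Family n
⨆ 𝒜 disjoint = mkFamily (concat (tabulate (members ∘ 𝒜)))
  (Unique.concat⁺ (All.tabulate⁺ (unique ∘ 𝒜))
    (AllPairs.tabulate⁺ λ i≢j (X∈𝒜ᵢ , X∈𝒜ⱼ) → disjoint i≢j X∈𝒜ᵢ X∈𝒜ⱼ))

size-⨆ : (𝒜 : Fin k → Family n) (disjoint : Disjoint 𝒜) →
         size (⨆ 𝒜 disjoint) ≡ ∑[ i < k ] size (𝒜 i)
size-⨆ 𝒜 _ = length-concat-tabulate (members ∘ 𝒜)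
  where
  length-concat-tabulate : ∀ {k} {A : Set} (f : Fin k → List A) →
                           length (concat (tabulate f)) ≡ ∑[ i < k ] length (f i)
  length-concat-tabulate {zero}  f = refl
  length-concat-tabulate {suc k} f =
    trans (length-++ (f zero)) (cong₂ _+_ refl (length-concat-tabulate (f ∘ suc)))

∈-⨆⁻ : (𝒜 : Fin k → Family n) (disjoint : Disjoint 𝒜) →
       ∀ {X} → X ∈ ⨆ 𝒜 disjoint → ∃ λ i → X ∈ 𝒜 i
∈-⨆⁻ 𝒜 _ X∈ with ∈-concat⁻′ (tabulate (members ∘ 𝒜)) X∈
... | _ , X∈xs , xs∈ with ∈-tabulate⁻ xs∈
... | i , refl = i , X∈xs

⨆-⊆ : (𝒜 : Fin k → Family n) (disjoint : Disjoint 𝒜) {ℬ : Family n} →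
      (∀ i → 𝒜 i ⊆ ℬ) → ⨆ 𝒜 disjoint ⊆ ℬ
⨆-⊆ 𝒜 disjoint 𝒜⊆ℬ X∈ with ∈-⨆⁻ 𝒜 disjoint X∈
... | i , X∈𝒜ᵢ = 𝒜⊆ℬ i X∈𝒜ᵢ

∑-size-disjoint : (𝒜 : Fin k → Family n) → Disjoint 𝒜 → {ℬ : Family n} →
                  (∀ i → 𝒜 i ⊆ ℬ) → ∑[ i < k ] size (𝒜 i) ≤ size ℬ
∑-size-disjoint 𝒜 disjoint {ℬ} 𝒜⊆ℬ =
  subst (_≤ size ℬ) (size-⨆ 𝒜 disjoint)
    (size-mono-⊆ {𝒜 = ⨆ 𝒜 disjoint} {ℬ} (⨆-⊆ 𝒜 disjoint {ℬ} 𝒜⊆ℬ))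

disjoint-covers : (𝒜 : Fin k → Family n) → Disjoint 𝒜 → {ℬ : Family n} → (∀ i → 𝒜 i ⊆ ℬ) →
                  size ℬ ≤ ∑[ i < k ] size (𝒜 i) → ∀ {X} → X ∈ ℬ → ∃ λ i → X ∈ 𝒜 i
disjoint-covers 𝒜 disjoint {ℬ} 𝒜⊆ℬ ∣ℬ∣≤∑ =
  ∈-⨆⁻ 𝒜 disjoint ∘
  ⊆∧≥⇒⊇ {𝒜 = ⨆ 𝒜 disjoint} {ℬ} (⨆-⊆ 𝒜 disjoint {ℬ} 𝒜⊆ℬ)
    (subst (size ℬ ≤_) (sym (size-⨆ 𝒜 disjoint)) ∣ℬ∣≤∑)

-- Intersecting families

MeetsOthers-antitone : ∀ {t} {𝒜 ℬ : Family n} → 𝒜 ⊆ ℬ → ∀ {X} →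
                       MeetsOthers t ℬ X → MeetsOthers t 𝒜 X
MeetsOthers-antitone 𝒜⊆ℬ meets = All.tabulate (All.lookup meets ∘ 𝒜⊆ℬ)

Intersecting-antitone : ∀ {t} {𝒜 ℬ : Family n} → 𝒜 ⊆ ℬ → Intersecting t ℬ → Intersecting t 𝒜
Intersecting-antitone {𝒜 = 𝒜} {ℬ} 𝒜⊆ℬ int =
  All.tabulate λ X∈𝒜 → MeetsOthers-antitone {𝒜 = 𝒜} {ℬ} 𝒜⊆ℬ (All.lookup int (𝒜⊆ℬ X∈𝒜))

∈-^+⁻ : ∀ t (𝒜 : Family n) {X} → X ∈ 𝒜 ^[ t ,+] → X ∈ 𝒜 × MeetsOthers t 𝒜 X
∈-^+⁻ t 𝒜 = ∈-filter⁻ (meetsOthers? t 𝒜) {xs = members 𝒜}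

^+-intersecting : ∀ t (𝒜 : Family n) → Intersecting t (𝒜 ^[ t ,+])
^+-intersecting t 𝒜 = All.tabulate λ X∈ →
  MeetsOthers-antitone {𝒜 = 𝒜 ^[ t ,+]} {𝒜} (proj₁ ∘ ∈-^+⁻ t 𝒜) (proj₂ (∈-^+⁻ t 𝒜 X∈))

-- The maximum defining `l` runs over the list `subfamilies ℱ`, so `𝒢` is replaced by the listed
-- family with the same members.
size≤l : ∀ {t} {𝒢 ℱ : Family n} → 𝒢 ⊆ ℱ → Intersecting t 𝒢 → size 𝒢 ≤ l ℱ t
size≤l {t = t} {𝒢} {ℱ} 𝒢⊆ℱ int with subfamilies-complete {𝒢 = 𝒢} {ℱ} 𝒢⊆ℱ
... | 𝒢′ , 𝒢′∈ , 𝒢′⊆𝒢 , 𝒢⊆𝒢′ = ≤-trans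
  (size-mono-⊆ {𝒜 = 𝒢} {𝒢′} 𝒢⊆𝒢′)
  (All.lookup (xs≤max 0 _) (∈-map⁺ size (∈-filter⁺ (intersecting? t) 𝒢′∈
    (Intersecting-antitone {𝒜 = 𝒢′} {𝒢} 𝒢′⊆𝒢 int))))

subfamilies-sound : {𝒢 ℱ : Family n} → 𝒢 ∈ˡ subfamilies ℱ → 𝒢 ⊆ ℱ
subfamilies-sound {ℱ = ℱ} 𝒢∈ X∈𝒢 with ∈-map⁻ _ 𝒢∈
... | S , _ , refl = proj₁ (∈-filter⁻ (_∈ˡ? S) {xs = members ℱ} X∈𝒢)

l-attained : ∀ (ℱ : Family n) t → ∃ λ ℒ → ℒ ⊆ ℱ × Intersecting t ℒ × size ℒ ≡ l ℱ t
l-attained ℱ t = argmax-all (λ m → m)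
  {P = λ m → ∃ λ ℒ → ℒ ⊆ ℱ × Intersecting t ℒ × size ℒ ≡ m}
  -- The empty family realises the default value `0` of the maximum.
  (mkFamily [] [] , (λ ()) , All.[] , refl)
  (All.map⁺ (All.tabulate λ {𝒢} 𝒢∈ →
    let 𝒢∈′ , int = ∈-filter⁻ (intersecting? t) {xs = subfamilies ℱ} 𝒢∈ in
    𝒢 , subfamilies-sound {𝒢 = 𝒢} {ℱ} 𝒢∈′ , int , refl))

-- Unlike in `Intersecting`, `X` and `Y` may coincide. A tuple with all entries equal to `ℒ` needs
-- this as soon as it has two entries.
SelfCross : ℕ → Family n → Set
SelfCross t ℒ = ∀ {X Y} → X ∈ ℒ → Y ∈ ℒ → t ≤ ∣ X ∩ Y ∣

selfCross : ∀ {t} {ℒ : Family n} → Intersecting t ℒ →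
            (∀ {X} → X ∈ ℒ → t ≤ ∣ X ∣) → SelfCross t ℒ
selfCross {t = t} int large {X} {Y} X∈ Y∈ with X ≟ˢ Y
... | yes refl = subst (λ Z → t ≤ ∣ Z ∣) (sym (∩-idem X)) (large X∈)
... | no  X≢Y  = All.lookup (All.lookup int X∈) Y∈ X≢Y

∃-large : ∀ {t} {ℱ : Family n} → 1 ≤ t → t ≤ α ℱ → ∃ λ X → X ∈ ℱ × t ≤ ∣ X ∣
∃-large {ℱ = ℱ} 1≤t t≤α with argmax-sel (λ m → m) 0 (map ∣_∣ (members ℱ))
-- `1 ≤ t` rules out the default value `0` of `α`.
... | inj₁ α≡0 = contradiction (≤-trans 1≤t (subst (_ ≤_) α≡0 t≤α)) λ ()
... | inj₂ α∈ with ∈-map⁻ ∣_∣ α∈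
... | X , X∈ℱ , α≡∣X∣ = X , X∈ℱ , subst (_ ≤_) α≡∣X∣ t≤α

-- The hypothesis on α matters only when l = 1: the single member of a largest
-- t-intersecting sub-family may then be too small, and has to be replaced.
l-attained-selfCross : ∀ {t} (ℱ : Family n) → 1 ≤ t → t ≤ α ℱ →
                       ∃ λ ℒ → ℒ ⊆ ℱ × SelfCross t ℒ × size ℒ ≡ l ℱ t
l-attained-selfCross {t = t} ℱ 1≤t t≤α with l-attained ℱ t
... | mkFamily [] _ , ℒ⊆ℱ , int , eq = mkFamily [] [] , ℒ⊆ℱ , (λ ()) , eq
... | mkFamily (_ ∷ []) _ , _ , _ , eq with ∃-large {ℱ = ℱ} 1≤t t≤α
... | X , X∈ℱ , t≤∣X∣ = mkFamily (X ∷ []) (All.[] ∷ []) , (λ { (here refl) → X∈ℱ }) ,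
  (λ { (here refl) (here refl) → subst (λ Z → t ≤ ∣ Z ∣) (sym (∩-idem X)) t≤∣X∣ }) , eq
l-attained-selfCross {t = t} ℱ _ _
    | ℒ@(mkFamily (X ∷ Y ∷ _) (X∉ ∷ _)) , ℒ⊆ℱ , int , eq =
  ℒ , ℒ⊆ℱ , selfCross {ℒ = ℒ} int large , eq
  where
  distinct⇒large : ∀ {Z W} → Z ∈ ℒ → W ∈ ℒ → Z ≢ W → t ≤ ∣ Z ∣
  distinct⇒large {Z} {W} Z∈ W∈ Z≢W =
    ≤-trans (All.lookup (All.lookup int Z∈) W∈ Z≢W) (∣p∩q∣≤∣p∣ Z W)

  large : ∀ {Z} → Z ∈ ℒ → t ≤ ∣ Z ∣
  -- Each member has a different one to meet: `X`, or `Y` in the case of `X` itself.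
  large {Z} Z∈ with Z ≟ˢ X
  ... | no  Z≢X  = distinct⇒large Z∈ (here refl) Z≢X
  ... | yes refl = distinct⇒large Z∈ (there (here refl)) (All.head X∉)

-- Rational inequalities

-- `i / m` is reduced to lowest terms, which may change numerator and denominator. Unnormalised
-- fractions keep them, and their order is cross-multiplication.
/-≤⇒*-≤ : ∀ {i j m n} .{{_ : NonZero m}} .{{_ : NonZero n}} →
          i / m ℚ.≤ j / n → i ℤ.* + n ℤ.≤ j ℤ.* + m
/-≤⇒*-≤ {i} {j} {suc m} {suc n} le = ℚᵘ.drop-*≤* (ℚᵘ.≤-respˡ-≃ (ℚ.toℚᵘ-fromℚᵘ (ℚᵘ.mkℚᵘ i m))
  (ℚᵘ.≤-respʳ-≃ (ℚ.toℚᵘ-fromℚᵘ (ℚᵘ.mkℚᵘ j n)) (ℚ.toℚᵘ-mono-≤ le)))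

/-<⇒*-< : ∀ {i j m n} .{{_ : NonZero m}} .{{_ : NonZero n}} →
          i / m ℚ.< j / n → i ℤ.* + n ℤ.< j ℤ.* + m
/-<⇒*-< {i} {j} {suc m} {suc n} lt = ℚᵘ.drop-*<* (ℚᵘ.<-respˡ-≃ (ℚ.toℚᵘ-fromℚᵘ (ℚᵘ.mkℚᵘ i m))
  (ℚᵘ.<-respʳ-≃ (ℚ.toℚᵘ-fromℚᵘ (ℚᵘ.mkℚᵘ j n)) (ℚ.toℚᵘ-mono-< lt)))

+/-≤⇒*-≤ : ∀ {a b m n} .{{_ : NonZero m}} .{{_ : NonZero n}} →
           + a / m ℚ.≤ + b / n → a * n ≤ b * m
+/-≤⇒*-≤ {a} {b} {m} {n} le = ℤ.drop‿+≤+
  (subst₂ ℤ._≤_ (sym (ℤ.pos-* a n)) (sym (ℤ.pos-* b m)) (/-≤⇒*-≤ {+ a} {+ b} le))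

+/-<⇒*-< : ∀ {a b m n} .{{_ : NonZero m}} .{{_ : NonZero n}} →
           + a / m ℚ.< + b / n → a * n < b * m
+/-<⇒*-< {a} {b} {m} {n} lt = ℤ.drop‿+<+
  (subst₂ ℤ._<_ (sym (ℤ.pos-* a n)) (sym (ℤ.pos-* b m)) (/-<⇒*-< {+ a} {+ b} lt))

-- The extremal ratio

-- The inequality `l / ∣ℱ∣ ≤ (l - ∣𝒜⁺∣) / ∣𝒜⁻∣` cleared of denominators, a form that also makes
-- sense for empty `𝒜⁻`.
WeightBound : (ℱ 𝒜 : Family n) → ℕ → Set
WeightBound ℱ 𝒜 t = l ℱ t * size (𝒜 ^[ t ,-]) + size ℱ * size (𝒜 ^[ t ,+]) ≤ size ℱ * l ℱ t

ratio⇒weightBound : ∀ {L N m p} .{{_ : NonZero N}} .{{_ : NonZero m}} → p ≤ L →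
                    + L / N ℚ.≤ (+ L ℤ.- + p) / m → L * m + N * p ≤ N * L
ratio⇒weightBound {L} {N} {m} {p} p≤L le = begin
  L * m + N * p        ≤⟨ +-monoˡ-≤ (N * p) (+/-≤⇒*-≤ {L} {L ∸ p} {N} {m} le′) ⟩
  (L ∸ p) * N + N * p  ≡⟨ cong₂ _+_ (*-comm (L ∸ p) N) refl ⟩
  N * (L ∸ p) + N * p  ≡⟨ *-distribˡ-+ N (L ∸ p) p ⟨
  N * (L ∸ p + p)      ≡⟨ cong (N *_) (m∸n+n≡m p≤L) ⟩
  N * L                ∎
  where
  open ≤-Reasoning
  le′ : + L / N ℚ.≤ + (L ∸ p) / m
  -- By `p ≤ L` the integer difference agrees with truncated subtraction.
  le′ = subst (λ i → + L / N ℚ.≤ i / m) (trans (ℤ.m-n≡m⊖n L p) (ℤ.⊖-≥ p≤L)) le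

βsub-suc : ∀ (ℱ : Family n) .{{_ : NonEmpty ℱ}} t (𝒜 : Family n) {m} →
           size (𝒜 ^[ t ,-]) ≡ suc m →
           βsub ℱ t 𝒜 ≡ (+ l ℱ t ℤ.- + size (𝒜 ^[ t ,+])) / suc m
βsub-suc ℱ t 𝒜 eq rewrite eq = refl

βsub⇒weightBound : ∀ (ℱ : Family n) .{{_ : NonEmpty ℱ}} t (𝒜 : Family n) →
                   size (𝒜 ^[ t ,+]) ≤ l ℱ t → + l ℱ t / size ℱ ℚ.≤ βsub ℱ t 𝒜 →
                   WeightBound ℱ 𝒜 t
βsub⇒weightBound ℱ t 𝒜 p≤l le = bound _ refl
  where
  bound : ∀ m → size (𝒜 ^[ t ,-]) ≡ m → l ℱ t * m + size ℱ * size (𝒜 ^[ t ,+]) ≤ size ℱ * l ℱ t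
  -- When `𝒜⁻` is empty, the value of `βsub` carries no information about `𝒜`; the bound comes from
  -- `∣𝒜⁺∣ ≤ l` instead.
  bound zero    _  = subst (λ x → x + size ℱ * size (𝒜 ^[ t ,+]) ≤ size ℱ * l ℱ t)
    (sym (*-zeroʳ (l ℱ t))) (*-monoʳ-≤ (size ℱ) p≤l)
  bound (suc m) eq = ratio⇒weightBound p≤l (subst (+ l ℱ t / size ℱ ℚ.≤_) (βsub-suc ℱ t 𝒜 eq) le)

β≡⇒weightBound : ∀ {ℱ : Family n} .{{_ : NonEmpty ℱ}} {t} → β ℱ t ≡ + l ℱ t / size ℱ →
                 ∀ {𝒜} → 𝒜 ∈ˡ subfamilies ℱ → WeightBound ℱ 𝒜 t
β≡⇒weightBound {ℱ = ℱ} {t} β≡ {𝒜} 𝒜∈ = βsub⇒weightBound ℱ t 𝒜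
  (size≤l {𝒢 = 𝒜 ^[ t ,+]} {ℱ} (subfamilies-sound {𝒢 = 𝒜} {ℱ} 𝒜∈ ∘ proj₁ ∘ ∈-^+⁻ t 𝒜)
    (^+-intersecting t 𝒜))
  (subst (ℚ._≤ βsub ℱ t 𝒜) β≡
    (All.lookup (min≤xs (βsub ℱ t ℱ) _) (∈-map⁺ (βsub ℱ t) 𝒜∈)))

-- Unions of cross-t-intersecting families

module _ {t} (𝒜 : Fin k → Family n) (cross : CrossIntersecting t 𝒜)
         (𝒰 : Family n) (𝒜⊆𝒰 : ∀ i → 𝒜 i ⊆ 𝒰) (𝒰⊆⋃𝒜 : ∀ {X} → X ∈ 𝒰 → ∃ λ i → X ∈ 𝒜 i) where

  private
    𝒰⁺ = 𝒰 ^[ t ,+]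
    𝒰⁻ = 𝒰 ^[ t ,-]

  -- Another member of `𝒰` lies in `𝒜 i`, where `meets` applies, or in some other `𝒜 j`, where the
  -- cross condition applies.
  meetsOthers⇒∈𝒰⁺ : ∀ {i X} → X ∈ 𝒜 i → MeetsOthers t (𝒜 i) X → X ∈ 𝒰⁺
  meetsOthers⇒∈𝒰⁺ {i} {X} X∈𝒜ᵢ meets =
    ∈-filter⁺ (meetsOthers? t 𝒰) (𝒜⊆𝒰 i X∈𝒜ᵢ) (All.tabulate meets𝒰)
    where
    meets𝒰 : ∀ {Y} → Y ∈ 𝒰 → X ≢ Y → t ≤ ∣ X ∩ Y ∣
    meets𝒰 Y∈𝒰 X≢Y with 𝒰⊆⋃𝒜 Y∈𝒰
    ... | j , Y∈𝒜ⱼ with i Fin.≟ j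
    ... | yes refl = All.lookup meets Y∈𝒜ⱼ X≢Y
    ... | no  i≢j  = cross i≢j X∈𝒜ᵢ Y∈𝒜ⱼ

  -- As a member of `𝒜 j`, the set meets all of `𝒜 i` by the cross condition, so the previous
  -- criterion applies to it within `𝒜 i`.
  shared⇒∈𝒰⁺ : ∀ {i j} → i ≢ j → ∀ {X} → X ∈ 𝒜 i → X ∈ 𝒜 j → X ∈ 𝒰⁺
  shared⇒∈𝒰⁺ i≢j X∈𝒜ᵢ X∈𝒜ⱼ =
    meetsOthers⇒∈𝒰⁺ X∈𝒜ᵢ (All.tabulate λ Y∈𝒜ᵢ _ → cross (i≢j ∘ sym) X∈𝒜ⱼ Y∈𝒜ᵢ)

  -- Outside `𝒰⁺` the families are pairwise disjoint, so their remainders together fit into `𝒰⁻`;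
  -- within `𝒰⁺` each contributes at most `size 𝒰⁺`.
  ∑-size-cross : ∑[ i < k ] size (𝒜 i) ≤ size 𝒰⁻ + k * size 𝒰⁺
  ∑-size-cross = begin
    ∑[ i < k ] size (𝒜 i)                               ≤⟨ ∑-mono-≤ (λ i → size≤size+size-∖ (𝒜 i) 𝒰⁺) ⟩
    ∑[ i < k ] (size 𝒰⁺ + size (𝒜 i ∖ 𝒰⁺))              ≡⟨ ∑-distrib-+ {k} (λ _ → size 𝒰⁺) (λ i → size (𝒜 i ∖ 𝒰⁺)) ⟩
    ∑[ i < k ] size 𝒰⁺ + ∑[ i < k ] size (𝒜 i ∖ 𝒰⁺)     ≤⟨ +-mono-≤ (≤-reflexive (∑-const k (size 𝒰⁺)))
                                                             (∑-size-disjoint (λ i → 𝒜 i ∖ 𝒰⁺) disjoint {𝒰⁻} 𝒜∖𝒰⁺⊆𝒰⁻) ⟩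
    k * size 𝒰⁺ + size 𝒰⁻                               ≡⟨ +-comm (k * size 𝒰⁺) (size 𝒰⁻) ⟩
    size 𝒰⁻ + k * size 𝒰⁺                               ∎
    where
    open ≤-Reasoning

    disjoint : Disjoint (λ i → 𝒜 i ∖ 𝒰⁺)
    disjoint {i} {j} i≢j X∈𝒜ᵢ∖ X∈𝒜ⱼ∖ =
      let X∈𝒜ᵢ , X∉𝒰⁺ = ∈-∖⁻ (𝒜 i) 𝒰⁺ X∈𝒜ᵢ∖ in
      X∉𝒰⁺ (shared⇒∈𝒰⁺ i≢j X∈𝒜ᵢ (proj₁ (∈-∖⁻ (𝒜 j) 𝒰⁺ X∈𝒜ⱼ∖)))

    𝒜∖𝒰⁺⊆𝒰⁻ : ∀ i → 𝒜 i ∖ 𝒰⁺ ⊆ 𝒰⁻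
    𝒜∖𝒰⁺⊆𝒰⁻ i X∈ =
      let X∈𝒜ᵢ , X∉𝒰⁺ = ∈-∖⁻ (𝒜 i) 𝒰⁺ X∈ in ∈-∖⁺ {𝒜 = 𝒰} {𝒰⁺} (𝒜⊆𝒰 i X∈𝒜ᵢ) X∉𝒰⁺

-- Maximum tuples

maximum≥size : ∀ {t} {ℱ : Family n} {𝒜 : Fin k → Family n} → 1 ≤ k → IsMaximumCross t ℱ 𝒜 →
               size ℱ ≤ ∑[ i < k ] size (𝒜 i)
maximum≥size {n} {suc k} {t} {ℱ} _ (_ , maximal) =
  ≤-trans (m≤m+n (size ℱ) _) (maximal ℬ (ℬ⊆ℱ , cross))
  where
  ℬ : Fin (suc k) → Family n
  ℬ zero    = ℱ
  ℬ (suc _) = mkFamily [] []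

  ℬ⊆ℱ : ∀ i → ℬ i ⊆ ℱ
  ℬ⊆ℱ zero X∈ = X∈

  cross : CrossIntersecting t ℬ
  cross {zero}  {zero}  0≢0 _  _  = contradiction refl 0≢0
  cross {zero}  {suc _} _   _  ()
  cross {suc _} {_}     _   ()

maximum≥k*l : ∀ {t} {ℱ : Family n} {𝒜 : Fin k → Family n} → 1 ≤ t → t ≤ α ℱ →
              IsMaximumCross t ℱ 𝒜 → k * l ℱ t ≤ ∑[ i < k ] size (𝒜 i)
maximum≥k*l {k = k} {t} {ℱ} {𝒜} 1≤t t≤α (_ , maximal) with l-attained-selfCross ℱ 1≤t t≤α
... | ℒ , ℒ⊆ℱ , cross , ∣ℒ∣≡l = subst (_≤ ∑[ i < k ] size (𝒜 i))
  (trans (∑-const k (size ℒ)) (cong (k *_) ∣ℒ∣≡l))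
  (maximal (λ _ → ℒ) ((λ _ → ℒ⊆ℱ) , (λ _ → cross)))

-- For the arithmetic, L = l, N = |ℱ|, m = |𝒰⁻|, p = |𝒰⁺| and S = ∑ᵢ |𝒜ᵢ|.
module _ {L N m p S} (k : ℕ) (weights : L * m + N * p ≤ N * L) (S≤ : S ≤ m + k * p) where

  open ≤-Reasoning

  private
    expandˡ : L * S ≤ L * m + (k * L) * p
    expandˡ = begin
      L * S                  ≤⟨ *-monoʳ-≤ L S≤ ⟩
      L * (m + k * p)        ≡⟨ rearrange L m k p ⟩
      L * m + (k * L) * p    ∎
      where
      rearrange : ∀ L m k p → L * (m + k * p) ≡ L * m + (k * L) * p
      rearrange = solve-∀

    expandʳ : N * S ≤ N * m + k * (N * p)
    expandʳ = begin
      N * S                  ≤⟨ *-monoʳ-≤ N S≤ ⟩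
      N * (m + k * p)        ≡⟨ rearrange N m k p ⟩
      N * m + k * (N * p)    ∎
      where
      rearrange : ∀ N m k p → N * (m + k * p) ≡ N * m + k * (N * p)
      rearrange = solve-∀

    boundˡ : L * m + N * p ≤ L * N
    boundˡ = subst (L * m + N * p ≤_) (*-comm N L) weights

    boundʳ : (k * L) * m + k * (N * p) ≤ N * (k * L)
    boundʳ = begin
      (k * L) * m + k * (N * p)  ≡⟨ collect k L m N p ⟩
      k * (L * m + N * p)        ≤⟨ *-monoʳ-≤ k weights ⟩
      k * (N * L)                ≡⟨ swap k N L ⟩
      N * (k * L)                ∎
      where
      collect : ∀ k L m N p → (k * L) * m + k * (N * p) ≡ k * (L * m + N * p)
      collect = solve-∀
      swap : ∀ k N L → k * (N * L) ≡ N * (k * L)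
      swap = solve-∀

  -- Scale by `L`: raising the coefficient `k * L` of `p` to `N` produces the left side of
  -- `weights`.
  k*L≤N⇒S≤N : .{{_ : NonZero L}} → k * L ≤ N → S ≤ N
  k*L≤N⇒S≤N kL≤N = *-cancelˡ-≤ L (begin
    L * S                ≤⟨ expandˡ ⟩
    L * m + (k * L) * p  ≤⟨ +-monoʳ-≤ (L * m) (*-monoˡ-≤ p kL≤N) ⟩
    L * m + N * p        ≤⟨ boundˡ ⟩
    L * N                ∎)

  -- Scale by `N` instead: raising the coefficient `N` of `m` to `k * L` produces `k` times the left
  -- side of `weights`.
  N≤k*L⇒S≤k*L : .{{_ : NonZero N}} → N ≤ k * L → S ≤ k * L
  N≤k*L⇒S≤k*L N≤kL = *-cancelˡ-≤ N (begin
    N * S                      ≤⟨ expandʳ ⟩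
    N * m + k * (N * p)        ≤⟨ +-monoˡ-≤ (k * (N * p)) (*-monoˡ-≤ m N≤kL) ⟩
    (k * L) * m + k * (N * p)  ≤⟨ boundʳ ⟩
    N * (k * L)                ∎)

  -- For positive `p`, raising its coefficient from `k * L` to `N` is a strict increase, so `S < N`.
  -- The next lemma treats the coefficient of `m` likewise.
  k*L<N⇒p≡0 : k * L < N → N ≤ S → p ≡ 0
  k*L<N⇒p≡0 kL<N N≤S = decidable-stable (p ≟ 0) λ p≢0 →
    let instance _ = ≢-nonZero p≢0 in
    <⇒≱ (*-cancelˡ-< L S N (begin-strict
      L * S                ≤⟨ expandˡ ⟩
      L * m + (k * L) * p  <⟨ +-monoʳ-< (L * m) (*-monoˡ-< p kL<N) ⟩
      L * m + N * p        ≤⟨ boundˡ ⟩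
      L * N                ∎)) N≤S

  N<k*L⇒m≡0 : N < k * L → k * L ≤ S → m ≡ 0
  N<k*L⇒m≡0 N<kL kL≤S = decidable-stable (m ≟ 0) λ m≢0 →
    let instance _ = ≢-nonZero m≢0 in
    <⇒≱ (*-cancelˡ-< N S (k * L) (begin-strict
      N * S                      ≤⟨ expandʳ ⟩
      N * m + k * (N * p)        <⟨ +-monoˡ-< (k * (N * p)) (*-monoˡ-< m N<kL) ⟩
      (k * L) * m + k * (N * p)  ≤⟨ boundʳ ⟩
      N * (k * L)                ∎)) kL≤S

-- Both ranges of `k`, read off from the union of a maximum tuple

theorem4p1 : ∀ {n} (t k : ℕ) → 1 ≤ t → 1 ≤ k →
    (ℱ : Family n) .{{_ : NonEmpty ℱ}} →
    t ≤ α ℱ →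
    β ℱ t ≡ + l ℱ t / size ℱ →
    (𝒜 : Fin k → Family n) → IsMaximumCross t ℱ 𝒜 →
    (+ k / 1 ℚ.≤ size/l ℱ t → ∑[ i < k ] size (𝒜 i) ≡ size ℱ) ×
    (+ k / 1 ℚ.≥ size/l ℱ t → ∑[ i < k ] size (𝒜 i) ≡ k * l ℱ t) ×
    (+ k / 1 ℚ.< size/l ℱ t →
      (∀ i → 𝒜 i ≈ 𝒜 i ^[ t ,-]) × Partitions 𝒜 ℱ) ×
    (+ k / 1 ℚ.> size/l ℱ t →
      ∃ λ ℒ → IsLargestIntersecting t ℱ ℒ × (∀ i → 𝒜 i ≈ ℒ))
theorem4p1 {n} t k@(suc _) 1≤t 1≤k ℱ t≤α β≡ 𝒜 𝒜-max@((𝒜⊆ℱ , cross) , _) =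
  (λ k≤ → ≤-antisym (k*L≤N⇒S≤N k weights S≤ (toℕ≤ k≤)) ∣ℱ∣≤S) ,
  (λ k≥ → ≤-antisym (N≤k*L⇒S≤k*L k weights S≤ (toℕ≥ k≥)) kl≤S) ,
  (λ k< → below (k*L<N⇒p≡0 k weights S≤ (toℕ< k<) ∣ℱ∣≤S)) ,
  (λ k> → above (N<k*L⇒m≡0 k weights S≤ (toℕ> k>) kl≤S))
  where
  instance
    l≢0 : NonZero (l ℱ t)
    l≢0 = l-nonZero ℱ t

  toℕ≤ : + k / 1 ℚ.≤ size/l ℱ t → k * l ℱ t ≤ size ℱ
  toℕ≤ k≤ = subst (k * l ℱ t ≤_) (*-identityʳ _) (+/-≤⇒*-≤ {k} {size ℱ} k≤)

  toℕ≥ : + k / 1 ℚ.≥ size/l ℱ t → size ℱ ≤ k * l ℱ t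
  toℕ≥ k≥ = subst (_≤ k * l ℱ t) (*-identityʳ _) (+/-≤⇒*-≤ {size ℱ} {k} k≥)

  toℕ< : + k / 1 ℚ.< size/l ℱ t → k * l ℱ t < size ℱ
  toℕ< k< = subst (k * l ℱ t <_) (*-identityʳ _) (+/-<⇒*-< {k} {size ℱ} k<)

  toℕ> : + k / 1 ℚ.> size/l ℱ t → size ℱ < k * l ℱ t
  toℕ> k> = subst (_< k * l ℱ t) (*-identityʳ _) (+/-<⇒*-< {size ℱ} {k} k>)

  ⋃𝒜 : Family n
  ⋃𝒜 = select (λ X → Fin.any? (λ i → X ∈? 𝒜 i)) ℱ

  ∈-⋃𝒜⁻ : ∀ {X} → X ∈ ⋃𝒜 → X ∈ ℱ × ∃ λ i → X ∈ 𝒜 i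
  ∈-⋃𝒜⁻ = ∈-filter⁻ (λ X → Fin.any? (λ i → X ∈? 𝒜 i)) {xs = members ℱ}

  -- `β` is a minimum over the listed sub-families, so the union is exchanged for its copy in that
  -- list.
  complete = subfamilies-complete {𝒢 = ⋃𝒜} {ℱ} (proj₁ ∘ ∈-⋃𝒜⁻)

  𝒰 : Family n
  𝒰 = proj₁ complete

  𝒰∈ : 𝒰 ∈ˡ subfamilies ℱ
  𝒰∈ = proj₁ (proj₂ complete)

  𝒜⊆𝒰 : ∀ i → 𝒜 i ⊆ 𝒰
  𝒜⊆𝒰 i X∈𝒜ᵢ = proj₂ (proj₂ (proj₂ complete))
    (∈-filter⁺ (λ X → Fin.any? (λ i → X ∈? 𝒜 i)) (𝒜⊆ℱ i X∈𝒜ᵢ) (i , X∈𝒜ᵢ))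

  𝒰⊆⋃𝒜 : ∀ {X} → X ∈ 𝒰 → ∃ λ i → X ∈ 𝒜 i
  𝒰⊆⋃𝒜 = proj₂ ∘ ∈-⋃𝒜⁻ ∘ proj₁ (proj₂ (proj₂ complete))

  weights : WeightBound ℱ 𝒰 t
  weights = β≡⇒weightBound {ℱ = ℱ} β≡ 𝒰∈

  S≤ : ∑[ i < k ] size (𝒜 i) ≤ size (𝒰 ^[ t ,-]) + k * size (𝒰 ^[ t ,+])
  S≤ = ∑-size-cross 𝒜 cross 𝒰 𝒜⊆𝒰 𝒰⊆⋃𝒜

  ∣ℱ∣≤S : size ℱ ≤ ∑[ i < k ] size (𝒜 i)
  ∣ℱ∣≤S = maximum≥size {ℱ = ℱ} {𝒜} 1≤k 𝒜-max

  kl≤S : k * l ℱ t ≤ ∑[ i < k ] size (𝒜 i)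
  kl≤S = maximum≥k*l {ℱ = ℱ} {𝒜} 1≤t t≤α 𝒜-max

  -- With `𝒰⁺` empty, no set is shared by two entries and none meets all others of its own entry.
  -- The disjoint entries have total size at least `size ℱ`, so they cover `ℱ`.
  below : size (𝒰 ^[ t ,+]) ≡ 0 → (∀ i → 𝒜 i ≈ 𝒜 i ^[ t ,-]) × Partitions 𝒜 ℱ
  below ∣𝒰⁺∣≡0 =
    (λ i → (λ X∈𝒜ᵢ → ∈-∖⁺ {𝒜 = 𝒜 i} {𝒜 i ^[ t ,+]} X∈𝒜ᵢ λ X∈𝒜ᵢ⁺ →
              ∉𝒰⁺ (meetsOthers⇒∈𝒰⁺ 𝒜 cross 𝒰 𝒜⊆𝒰 𝒰⊆⋃𝒜 X∈𝒜ᵢ (proj₂ (∈-^+⁻ t (𝒜 i) X∈𝒜ᵢ⁺)))) ,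
           (proj₁ ∘ ∈-∖⁻ (𝒜 i) (𝒜 i ^[ t ,+]))) ,
    𝒜⊆ℱ , disjoint-covers 𝒜 disjoint {ℱ} 𝒜⊆ℱ ∣ℱ∣≤S , disjoint
    where
    ∉𝒰⁺ : ∀ {X} → X ∉ 𝒰 ^[ t ,+]
    ∉𝒰⁺ = size≡0⇒∉ (𝒰 ^[ t ,+]) ∣𝒰⁺∣≡0

    disjoint : Disjoint 𝒜
    disjoint i≢j X∈𝒜ᵢ X∈𝒜ⱼ = ∉𝒰⁺ (shared⇒∈𝒰⁺ 𝒜 cross 𝒰 𝒜⊆𝒰 𝒰⊆⋃𝒜 i≢j X∈𝒜ᵢ X∈𝒜ⱼ)

  -- With `𝒰⁻` empty, `𝒰` is t-intersecting, so every entry has at most `l ℱ t` members. A sum of at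
  -- least `k * l ℱ t` then leaves no slack: each entry has exactly that many and fills `𝒰`.
  above : size (𝒰 ^[ t ,-]) ≡ 0 → ∃ λ ℒ → IsLargestIntersecting t ℱ ℒ × (∀ i → 𝒜 i ≈ ℒ)
  above ∣𝒰⁻∣≡0 =
    𝒰 , (𝒰⊆ℱ , 𝒰-intersecting , λ 𝒢 𝒢⊆ℱ int →
      ≤-trans (size≤l {𝒢 = 𝒢} {ℱ} 𝒢⊆ℱ int)
        (≤-trans (l≤∣𝒜∣ zero) (size-mono-⊆ {𝒜 = 𝒜 zero} {𝒰} (𝒜⊆𝒰 zero)))) ,
    λ i → 𝒜⊆𝒰 i , ⊆∧≥⇒⊇ {𝒜 = 𝒜 i} {𝒰} (𝒜⊆𝒰 i) (≤-trans ∣𝒰∣≤l (l≤∣𝒜∣ i))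
    where
    𝒰⊆ℱ : 𝒰 ⊆ ℱ
    𝒰⊆ℱ = subfamilies-sound {𝒢 = 𝒰} {ℱ} 𝒰∈

    𝒰⊆𝒰⁺ : 𝒰 ⊆ 𝒰 ^[ t ,+]
    𝒰⊆𝒰⁺ {X} X∈𝒰 = decidable-stable (X ∈? 𝒰 ^[ t ,+]) λ X∉𝒰⁺ →
      size≡0⇒∉ (𝒰 ^[ t ,-]) ∣𝒰⁻∣≡0 (∈-∖⁺ {𝒜 = 𝒰} {𝒰 ^[ t ,+]} X∈𝒰 X∉𝒰⁺)

    𝒰-intersecting : Intersecting t 𝒰
    𝒰-intersecting = Intersecting-antitone {𝒜 = 𝒰} {𝒰 ^[ t ,+]} 𝒰⊆𝒰⁺ (^+-intersecting t 𝒰)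

    ∣𝒰∣≤l : size 𝒰 ≤ l ℱ t
    ∣𝒰∣≤l = size≤l {𝒢 = 𝒰} {ℱ} 𝒰⊆ℱ 𝒰-intersecting

    l≤∣𝒜∣ : ∀ i → l ℱ t ≤ size (𝒜 i)
    l≤∣𝒜∣ = ∑-mono-≤-tight (λ i → ≤-trans (size-mono-⊆ {𝒜 = 𝒜 i} {𝒰} (𝒜⊆𝒰 i)) ∣𝒰∣≤l)
      (subst (_≤ ∑[ i < k ] size (𝒜 i)) (sym (∑-const k (l ℱ t))) kl≤S)
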